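{- For every sufficiently large $N$ there is a graph $G$ on $N$ vertices with minimum degree at least $2^{ -8}N$ whose edges cannot be covered by $\frac12\log_2 N$ subgraphs each of diameter at most $4$.
   Context: The diameter of a connected graph is the maximum distance between two vertices; a disconnected graph has diameter $\infty$. -}

module Defs where

open import Data.Nat using (ℕ; zero; suc; _+_)
open import Data.Bool using (Bool; true; false; if_then_else_)
open import Data.Fin using (Fin)
open import Data.List using (List; map; allFin)
open import Data.Nat.ListAction using (sum)
open import Data.Product using (_×_; ∃-syntax)
open import Relation.Binary.PropositionalEquality using (_≡_)

record Graph (n : ℕ) : Set where
  field
    adj   : Fin n → Fin n → Bool
    sym   : ∀ u v → adj u v ≡ adj v u
    irref : ∀ v → adj v v ≡ false
open Graph public

degree : ∀ {n} → Graph n → Fin n → ℕ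
degree {n} G v = sum (map (λ w → if adj G v w then 1 else 0) (allFin n))

record Subgraph {n : ℕ} (G : Graph n) : Set where
  field
    vert   : Fin n → Bool
    edge   : Fin n → Fin n → Bool
    esym   : ∀ u v → edge u v ≡ edge v u
    e⊆G    : ∀ u v → edge u v ≡ true → adj G u v ≡ true
    e⊆vert : ∀ u v → edge u v ≡ true → vert u ≡ true × vert v ≡ true
open Subgraph public

data Walk {n : ℕ} (E : Fin n → Fin n → Bool) : ℕ → Fin n → Fin n → Set where
  here : ∀ {k u} → Walk E k u u
  step : ∀ {k u w v} → E u w ≡ true → Walk E k w v → Walk E (suc k) u v

DiamAtMost : ∀ {n} {G : Graph n} → ℕ → Subgraph G → Set
DiamAtMost d H = ∀ u v → vert H u ≡ true → vert H v ≡ true → Walk (edge H) d u v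

CoversEdges : ∀ {n k} (G : Graph n) → (Fin k → Subgraph G) → Set
CoversEdges {n} {k} G H = ∀ u v → adj G u v ≡ true → ∃[ i ] edge (H i) u v ≡ true

{-# OPTIONS --safe #-}
module Submission where

-- Let M = 2 ^ (K - 1), where 4 ^ K ≤ N < 4 ^ (K + 1). For each pair i, j of the M indices take
-- an edge between a vertex a(i,j) on one side and a vertex b(i,j) on the other, and join each end
-- to the points x of its own side with f_i(x) = 1 and f_j(x) = 0, for affine forms f_i over
-- the field of two elements. These sets have positive density for i ≠ j, but those of (i , j)
-- and (j , l) are disjoint, which puts a(i,j) at distance at least 5 from b(j,l). So a subgraph
-- of diameter at most 4 contains at most one of the two edges, and a cover by K subgraphs
-- colours the arcs of the complete digraph on M vertices so that consecutive arcs differ. The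
-- sets of colours leaving each vertex then form an antichain of M subsets of a K-set; splitting
-- off three elements, whose eight subsets form three chains, gives M ≤ 3 · 2 ^ (K - 3), which
-- is less than 2 ^ (K - 1).

open import Defs hiding (sym)
open import Data.Nat using (ℕ; zero; suc; _≤_; _<_; _+_; _*_; _^_; _∸_; z≤n; s≤s)
open import Data.Nat.Properties
open import Data.Nat.ListAction using (sum)
open import Data.Nat.ListAction.Properties using (sum-++)
open import Data.Bool using (Bool; true; false; not; _∧_; _xor_; if_then_else_)
import Data.Bool.Properties as Bool
open import Data.Fin.Subset as Subset using (Subset; _⊆_)
open import Data.Fin.Subset.Properties using (_⊆?_; anySubset?; drop-∷-⊆)
open import Data.Fin using (Fin; zero; suc; inject≤; combine; remQuot)
import Data.Fin.Properties as Fin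
open import Data.List using (List; []; _∷_; [_]; _++_; map; length; lookup; replicate; allFin; tabulate; cartesianProduct; cartesianProductWith)
import Data.List.Properties as List
open import Data.List.Membership.Propositional using (_∈_)
open import Data.List.Membership.Propositional.Properties using (∈-cartesianProduct⁺; ∈-cartesianProductWith⁺; ∈-++⁺ˡ)
import Data.List.Relation.Unary.Any as Any
open import Data.List.Relation.Unary.Any.Properties using (lookup-index)
open import Data.Vec as Vec using (Vec; []; _∷_)
import Data.Vec.Properties as Vec
open import Data.Product using (_×_; _,_; proj₁; proj₂; ∃-syntax)
open import Data.Sum using (_⊎_; inj₁; inj₂)
open import Data.Empty using (⊥)
open import Function using (_∘_; mk⇔; Inverse)
open import Relation.Nullary using (¬_; Dec; yes; no; does; contradiction)
open import Relation.Nullary.Decidable using (_×-dec_; _⊎-dec_; ¬?; does-⇔; dec-true; dec-false; decidable-stable; from-no; from-yes)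
open import Relation.Binary.PropositionalEquality hiding ([_])

-- Sums over lists and products of lists.

module _ {A : Set} where

  Σ : List A → (A → ℕ) → ℕ
  Σ xs φ = sum (map φ xs)

  Σ-lower : ∀ xs {φ : A → ℕ} {c} → (∀ x → c ≤ φ x) → length xs * c ≤ Σ xs φ
  Σ-lower []       c≤φ = z≤n
  Σ-lower (x ∷ xs) c≤φ = +-mono-≤ (c≤φ x) (Σ-lower xs c≤φ)

  Σ-++ : ∀ xs ys (φ : A → ℕ) → Σ (xs ++ ys) φ ≡ Σ xs φ + Σ ys φ
  Σ-++ xs ys φ = trans (cong sum (List.map-++ φ xs ys)) (sum-++ (map φ xs) (map φ ys))

Σ-lookup : ∀ {A : Set} xs (φ : A → ℕ) → Σ (allFin (length xs)) (φ ∘ lookup xs) ≡ Σ xs φ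
Σ-lookup xs φ = cong sum (begin
  map (φ ∘ lookup xs) (allFin (length xs)) ≡⟨ List.map-tabulate (λ i → i) (φ ∘ lookup xs) ⟩
  tabulate (φ ∘ lookup xs)                 ≡⟨ List.map-tabulate (lookup xs) φ ⟨
  map φ (tabulate (lookup xs))             ≡⟨ cong (map φ) (List.tabulate-lookup xs) ⟩
  map φ xs                                 ∎)
  where open ≡-Reasoning

Σ-map : ∀ {A B : Set} (f : A → B) xs (φ : B → ℕ) → Σ (map f xs) φ ≡ Σ xs (φ ∘ f)
Σ-map f xs φ = cong sum (sym (List.map-∘ xs))

module _ {A B C : Set} (f : A → B → C) where

  Σ-cartesianProductWith : ∀ xs ys φ →
    Σ (cartesianProductWith f xs ys) φ ≡ Σ xs (λ x → Σ ys (λ y → φ (f x y)))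
  Σ-cartesianProductWith []       ys φ = refl
  Σ-cartesianProductWith (x ∷ xs) ys φ = trans
    (Σ-++ (map (f x) ys) (cartesianProductWith f xs ys) φ)
    (cong₂ _+_ (Σ-map (f x) ys φ) (Σ-cartesianProductWith xs ys φ))

  length-cartesianProductWith : ∀ xs ys →
    length (cartesianProductWith f xs ys) ≡ length xs * length ys
  length-cartesianProductWith []       ys = refl
  length-cartesianProductWith (x ∷ xs) ys = trans
    (List.length-++ (map (f x) ys))
    (cong₂ _+_ (List.length-map (f x) ys) (length-cartesianProductWith xs ys))

-- Enumeration of Boolean words.

bits : List Bool
bits = true ∷ false ∷ []

bits-complete : ∀ b → b ∈ bits
bits-complete true  = Any.here refl
bits-complete false = Any.there (Any.here refl)

Σ-bits-lower : ∀ (φ : Bool → ℕ) {c} b → c ≤ φ b → c ≤ Σ bits φ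
Σ-bits-lower φ true  c≤φ = m≤n⇒m≤n+o _ c≤φ
Σ-bits-lower φ false c≤φ = m≤n⇒m≤o+n (φ true) (m≤n⇒m≤n+o 0 c≤φ)

words : ∀ n → List (Vec Bool n)
words zero    = [ [] ]
words (suc n) = cartesianProductWith (λ v b → b ∷ v) (words n) bits

words-complete : ∀ {n} (v : Vec Bool n) → v ∈ words n
words-complete []      = Any.here refl
words-complete (b ∷ v) = ∈-cartesianProductWith⁺ (λ v b → b ∷ v) (words-complete v) (bits-complete b)

length-words : ∀ n → length (words n) ≡ 2 ^ n
length-words zero    = refl
length-words (suc n) = begin
  length (words (suc n)) ≡⟨ length-cartesianProductWith (λ v b → b ∷ v) (words n) bits ⟩
  length (words n) * 2   ≡⟨ cong (_* 2) (length-words n) ⟩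
  2 ^ n * 2              ≡⟨ *-comm (2 ^ n) 2 ⟩
  2 ^ suc n              ∎
  where open ≡-Reasoning

Σ-words-suc : ∀ n (φ : Vec Bool (suc n) → ℕ) →
  Σ (words (suc n)) φ ≡ Σ (words n) (λ v → Σ bits (λ b → φ (b ∷ v)))
Σ-words-suc n φ = Σ-cartesianProductWith (λ v b → b ∷ v) (words n) bits φ

Σ-words-lower : ∀ n {φ : Vec Bool n → ℕ} {c} → (∀ v → c ≤ φ v) → 2 ^ n * c ≤ Σ (words n) φ
Σ-words-lower n {φ} {c} c≤φ = subst (λ l → l * c ≤ Σ (words n) φ) (length-words n) (Σ-lower (words n) c≤φ)

-- The good first bit may depend on the rest of the word, so this applies when exactly half of the
-- words are good.
Σ-words-some-head : ∀ n {φ : Vec Bool (suc n) → ℕ} {c} →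
  (∀ v → ∃[ b ] c ≤ φ (b ∷ v)) → 2 ^ n * c ≤ Σ (words (suc n)) φ
Σ-words-some-head n {φ} c≤φ = subst (_ ≤_) (sym (Σ-words-suc n φ))
  (Σ-words-lower n (λ v → Σ-bits-lower (λ b → φ (b ∷ v)) (proj₁ (c≤φ v)) (proj₂ (c≤φ v))))

4^n≡2^n*2^n : ∀ n → 4 ^ n ≡ 2 ^ n * 2 ^ n
4^n≡2^n*2^n n = begin
  4 ^ n           ≡⟨ ^-*-assoc 2 2 n ⟩
  2 ^ (2 * n)     ≡⟨ cong (λ m → 2 ^ (n + m)) (+-identityʳ n) ⟩
  2 ^ (n + n)     ≡⟨ ^-distribˡ-+-* 2 n n ⟩
  2 ^ n * 2 ^ n   ∎
  where open ≡-Reasoning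

-- Affine forms over the field of two elements.

xor-involutive : ∀ x y → x xor (x xor y) ≡ y
xor-involutive true  y = Bool.not-involutive y
xor-involutive false y = refl

xor-cancelˡ : ∀ x {y z} → x xor y ≡ x xor z → y ≡ z
xor-cancelˡ x eq = trans (sym (xor-involutive x _)) (trans (cong (x xor_) eq) (xor-involutive x _))

-- As functions of `b` the two sides have different slopes, so their sum is nonconstant in `b` and
-- takes the value one.
xor-separate : ∀ {x y} s t → x ≢ y → ∃[ b ] (x ∧ b) xor s ≢ (y ∧ b) xor t
xor-separate {true}  {true}  s     t     x≢y = contradiction refl x≢y
xor-separate {false} {false} s     t     x≢y = contradiction refl x≢y
xor-separate {true}  {false} true  true  _   = true  , λ ()
xor-separate {true}  {false} true  false _   = false , λ ()
xor-separate {true}  {false} false true  _   = false , λ ()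
xor-separate {true}  {false} false false _   = true  , λ ()
xor-separate {false} {true}  true  true  _   = true  , λ ()
xor-separate {false} {true}  true  false _   = false , λ ()
xor-separate {false} {true}  false true  _   = false , λ ()
xor-separate {false} {true}  false false _   = true  , λ ()

affine : ∀ {n} → Bool → Vec Bool n → Vec Bool n → Bool
affine p []      []      = p
affine p (a ∷ u) (b ∷ r) = (a ∧ b) xor affine p u r

affine-surjective : ∀ {n} (u r : Vec Bool n) b → ∃[ p ] affine p u r ≡ b
affine-surjective []      []      b = b , refl
affine-surjective (a ∷ u) (c ∷ r) b with affine-surjective u r ((a ∧ c) xor b)
... | p , eq = p , trans (cong ((a ∧ c) xor_) eq) (xor-involutive (a ∧ c) b)

-- Distinct affine forms differ on at least half of the points: at a coordinate where the
-- coefficients differ, one of its two values separates the forms whatever the other coordinates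
-- are. Equal leading coefficients cancel, and if all coefficients agree the constant terms differ.
Σ-affine-lower : ∀ {n} p q (u v : Vec Bool n) → p ∷ u ≢ q ∷ v → ∀ {φ : Vec Bool n → ℕ} {c} →
  (∀ r → affine p u r ≢ affine q v r → c ≤ φ r) → 2 ^ n * c ≤ 2 * Σ (words n) φ
Σ-affine-lower p q [] [] i≢j {φ} {c} c≤φ =
  *-mono-≤ {1} {2} (s≤s z≤n) (m≤n⇒m≤n+o 0 (c≤φ [] λ { refl → i≢j refl }))
Σ-affine-lower {suc n} p q (a ∷ u) (b ∷ v) i≢j {φ} {c} c≤φ with a Bool.≟ b
... | no a≢b = begin
  2 * 2 ^ n * c              ≡⟨ *-assoc 2 (2 ^ n) c ⟩
  2 * (2 ^ n * c)            ≤⟨ *-monoʳ-≤ 2 (Σ-words-some-head n separated) ⟩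
  2 * Σ (words (suc n)) φ    ∎
  where
  open ≤-Reasoning
  separated : ∀ r → ∃[ d ] c ≤ φ (d ∷ r)
  separated r with xor-separate (affine p u r) (affine q v r) a≢b
  ... | d , ≢ = d , c≤φ (d ∷ r) ≢
... | yes refl = begin
  2 * 2 ^ n * c              ≡⟨ cong (_* c) (*-comm 2 (2 ^ n)) ⟩
  2 ^ n * 2 * c              ≡⟨ *-assoc (2 ^ n) 2 c ⟩
  2 ^ n * (2 * c)            ≤⟨ Σ-affine-lower p q u v (λ { refl → i≢j refl }) both ⟩
  2 * Σ (words n) (λ r → Σ bits (λ d → φ (d ∷ r))) ≡⟨ cong (2 *_) (Σ-words-suc n φ) ⟨
  2 * Σ (words (suc n)) φ    ∎
  where
  open ≤-Reasoning
  both : ∀ r → affine p u r ≢ affine q v r → 2 * c ≤ Σ bits (λ d → φ (d ∷ r))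
  both r ≢ = +-mono-≤ (c≤φ _ (≢ ∘ xor-cancelˡ (a ∧ true)))
    (+-mono-≤ (c≤φ _ (≢ ∘ xor-cancelˡ (a ∧ false))) z≤n)

-- This is f_i(x) for i = `p ∷ u`, with `p` the constant term. The first coordinate `b` of the point
-- always has coefficient one, so the value can be adjusted through the point (by `b`) as well as
-- through the index (by `p`), and `b` cancels in f_i + f_j.
evaluate : ∀ {n} → Vec Bool (suc n) → Vec Bool (suc n) → Bool
evaluate (p ∷ u) (b ∷ r) = b xor affine p u r

-- Stars: the sets f_i = 1, f_j = 0 and their densities.

module _ {n : ℕ} where

  -- The diagonal i ≡ j is filled in only to keep the minimum degree linear.
  Star : (i j x : Vec Bool (suc n)) → Set
  Star i j x = i ≡ j ⊎ (evaluate i x ≡ true × evaluate j x ≡ false)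

  Star? : ∀ i j x → Dec (Star i j x)
  Star? i j x = Vec.≡-dec Bool._≟_ i j ⊎-dec
    (evaluate i x Bool.≟ true ×-dec evaluate j x Bool.≟ false)

  Star-disjoint : ∀ {i j l x} → i ≢ j → j ≢ l → Star i j x → ¬ Star j l x
  Star-disjoint i≢j j≢l (inj₁ i≡j)       _                = i≢j i≡j
  Star-disjoint i≢j j≢l _                (inj₁ j≡l)       = j≢l j≡l
  Star-disjoint i≢j j≢l (inj₂ (_ , j≡0)) (inj₂ (j≡1 , _)) with () ← trans (sym j≡0) j≡1

  -- A star has density at least a quarter. Off the diagonal, the forms differ for half of the tails
  -- `r`, and for each of these the first bit `affine q v r` makes f_j vanish, hence f_i equal one.
  Σ-Star-points-lower : ∀ i j {φ : Vec Bool (suc n) → ℕ} {c} →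
    (∀ x → Star i j x → c ≤ φ x) → 2 ^ n * c ≤ 2 * Σ (words (suc n)) φ
  Σ-Star-points-lower i@(p ∷ u) j@(q ∷ v) {φ} {c} c≤φ with Vec.≡-dec Bool._≟_ i j
  ... | yes i≡j = ≤-trans (Σ-words-some-head n (λ r → true , c≤φ (true ∷ r) (inj₁ i≡j))) (m≤m+n _ _)
  ... | no  i≢j = subst (λ s → _ ≤ 2 * s) (sym (Σ-words-suc n φ)) (Σ-affine-lower p q u v i≢j head)
    where
    separate : ∀ {s t} → s ≢ t → t xor s ≡ true × t xor t ≡ false
    separate {s} {t} s≢t = trans (cong (t xor_) (Bool.¬-not s≢t)) (Bool.xor-inverseʳ t) , Bool.xor-same t
    head : ∀ r → affine p u r ≢ affine q v r → c ≤ Σ bits (λ b → φ (b ∷ r))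
    head r ≢ = Σ-bits-lower (λ b → φ (b ∷ r)) (affine q v r) (c≤φ (affine q v r ∷ r) (inj₂ (separate ≢)))

  -- The constant terms of i and j can be fitted to `x` independently for any coefficients, so a
  -- quarter of all pairs have `x` in their star.
  Σ-Star-arcs-lower : ∀ x {φ : Vec Bool (suc n) → Vec Bool (suc n) → ℕ} {c} →
    (∀ i j → Star i j x → c ≤ φ i j) →
    2 ^ n * (2 ^ n * c) ≤ Σ (words (suc n)) (λ i → Σ (words (suc n)) (φ i))
  Σ-Star-arcs-lower (b ∷ r) c≤φ =
    Σ-words-some-head n λ u → let p , p≡ = takes u true in p ,
    Σ-words-some-head n λ v → let q , q≡ = takes v false in q ,
    c≤φ (p ∷ u) (q ∷ v) (inj₂ (p≡ , q≡))
    where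
    takes : ∀ u c → ∃[ p ] evaluate (p ∷ u) (b ∷ r) ≡ c
    takes u c with affine-surjective u r (b xor c)
    ... | p , eq = p , trans (cong (b xor_) eq) (xor-involutive b c)

-- Splitting walks.

module _ {n : ℕ} {E : Fin n → Fin n → Bool} where

  Walk-split : ∀ k {l u v} → Walk E (k + l) u v → ∃[ w ] Walk E k u w × Walk E l w v
  Walk-split zero    p          = _ , here , p
  -- `here` fits any length bound, so a walk that stops early is split at its end.
  Walk-split (suc k) here       = _ , here , here
  Walk-split (suc k) (step e p) with Walk-split k p
  ... | w , q , r = w , step e q , r

does-true : ∀ {A : Set} (a? : Dec A) → does a? ≡ true → A
does-true (yes a) _ = a

-- The graph and its balls of radius two.

module Construction (n : ℕ) where

  Index : Set
  Index = Vec Bool (suc n)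

  -- On each side, arcs (i , j) of the complete digraph on Index, and points x with 2 ^ suc n
  -- copies, labelled by z, to make them a positive proportion of all vertices.
  Vertex : Set
  Vertex = Bool × Bool × Index × Index

  pattern arc s i j   = s , true  , i , j
  pattern point s x z = s , false , x , z

  Adj : Vertex → Vertex → Set
  Adj (arc s i j)   (arc t k l)   = s ≢ t × i ≡ k × j ≡ l
  Adj (arc s i j)   (point t x _) = s ≡ t × Star i j x
  Adj (point s x _) (arc t i j)   = s ≡ t × Star i j x
  Adj (point _ _ _) (point _ _ _) = ⊥

  Adj? : ∀ v w → Dec (Adj v w)
  Adj? (arc s i j)   (arc t k l)   = ¬? (s Bool.≟ t) ×-dec Vec.≡-dec Bool._≟_ i k ×-dec Vec.≡-dec Bool._≟_ j l
  Adj? (arc s i j)   (point t x _) = s Bool.≟ t ×-dec Star? i j x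
  Adj? (point s x _) (arc t i j)   = s Bool.≟ t ×-dec Star? i j x
  Adj? (point _ _ _) (point _ _ _) = no λ ()

  Adj-sym : ∀ v w → Adj v w → Adj w v
  Adj-sym (arc _ _ _)   (arc _ _ _)   (s≢t , i≡k , j≡l) = s≢t ∘ sym , sym i≡k , sym j≡l
  Adj-sym (arc _ _ _)   (point _ _ _) (s≡t , x∈S)       = sym s≡t , x∈S
  Adj-sym (point _ _ _) (arc _ _ _)   (s≡t , x∈S)       = sym s≡t , x∈S

  Adj-irrefl : ∀ v → ¬ Adj v v
  Adj-irrefl (arc _ _ _) (s≢s , _) = s≢s refl

  Near : Vertex → Vertex → Set
  Near v w = v ≡ w ⊎ Adj v w ⊎ ∃[ m ] Adj v m × Adj m w

  Near-sym : ∀ v w → Near v w → Near w v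
  Near-sym v w (inj₁ v≡w)                  = inj₁ (sym v≡w)
  Near-sym v w (inj₂ (inj₁ vw))            = inj₂ (inj₁ (Adj-sym v w vw))
  Near-sym v w (inj₂ (inj₂ (m , vm , mw))) = inj₂ (inj₂ (m , Adj-sym m w mw , Adj-sym v m vm))

  -- A superset of the ball of radius two around `arc s i j`. Points carry no side, because crossing
  -- to the other end of the edge reaches the same star there; arcs reached through a point stay on
  -- side `s`.
  Ball : Bool → Index → Index → Vertex → Set
  Ball s i j (arc t k l)   = (i ≡ k × j ≡ l) ⊎ (s ≡ t × ∃[ x ] Star i j x × Star k l x)
  Ball s i j (point _ x _) = Star i j x

  Near⇒Ball : ∀ s i j w → Near (arc s i j) w → Ball s i j w
  Near⇒Ball s i j w             (inj₁ refl)                                            = inj₁ (refl , refl)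
  Near⇒Ball s i j (arc _ _ _)   (inj₂ (inj₁ (_ , i≡k , j≡l)))                          = inj₁ (i≡k , j≡l)
  Near⇒Ball s i j (point _ _ _) (inj₂ (inj₁ (_ , x∈S)))                                = x∈S
  Near⇒Ball s i j (arc _ _ _)   (inj₂ (inj₂ (arc _ _ _ , (_ , refl , refl) , _ , eqs))) = inj₁ eqs
  Near⇒Ball s i j (point _ _ _) (inj₂ (inj₂ (arc _ _ _ , (_ , refl , refl) , _ , x∈S))) = x∈S
  Near⇒Ball s i j (arc _ _ _)   (inj₂ (inj₂ (point _ x _ , (refl , x∈S) , s≡t , x∈T)))  = inj₂ (s≡t , x , x∈S , x∈T)

  -- A common point would lie in two disjoint stars. A common arc labelled by one of the two pairs
  -- would give either `i ≡ j` or a point in both stars; an arc reached through points from both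
  -- centres would be on both sides.
  Ball-disjoint : ∀ {i j l} → i ≢ j → j ≢ l → ∀ w → Ball true i j w → ¬ Ball false j l w
  Ball-disjoint i≢j j≢l (point _ _ _) x∈S x∈T = Star-disjoint i≢j j≢l x∈S x∈T
  Ball-disjoint i≢j j≢l (arc _ _ _) (inj₁ (refl , _)) (inj₁ (j≡i , _)) = i≢j (sym j≡i)
  Ball-disjoint i≢j j≢l (arc _ _ _) (inj₁ (refl , refl)) (inj₂ (_ , x , x∈T , x∈S)) = Star-disjoint i≢j j≢l x∈S x∈T
  Ball-disjoint i≢j j≢l (arc _ _ _) (inj₂ (_ , x , x∈S , x∈T)) (inj₁ (refl , refl)) = Star-disjoint i≢j j≢l x∈S x∈T
  Ball-disjoint i≢j j≢l (arc _ _ _) (inj₂ (refl , _)) (inj₂ (() , _))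

  -- Vertex count and minimum degree.

  indices : List Index
  indices = words (suc n)

  pairs : List (Index × Index)
  pairs = cartesianProduct indices indices

  vertices : List Vertex
  vertices = cartesianProduct bits (cartesianProduct bits pairs)

  vertices-complete : ∀ v → v ∈ vertices
  vertices-complete (s , t , i , j) =
    ∈-cartesianProduct⁺ (bits-complete s) (∈-cartesianProduct⁺ (bits-complete t)
      (∈-cartesianProduct⁺ (words-complete i) (words-complete j)))

  length-vertices : length vertices ≡ 4 ^ (2 + n)
  length-vertices = begin
    length vertices                               ≡⟨ length-cartesianProductWith _,_ bits (cartesianProduct bits pairs) ⟩
    2 * length (cartesianProduct bits pairs)
      ≡⟨ cong (2 *_) (length-cartesianProductWith _,_ bits pairs) ⟩
    2 * (2 * length pairs)
      ≡⟨ cong (λ l → 2 * (2 * l)) (length-cartesianProductWith _,_ indices indices) ⟩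
    2 * (2 * (length indices * length indices))   ≡⟨ cong (λ l → 2 * (2 * (l * l))) (length-words (suc n)) ⟩
    2 * (2 * (2 ^ suc n * 2 ^ suc n))             ≡⟨ *-assoc 2 2 (2 ^ suc n * 2 ^ suc n) ⟨
    4 * (2 ^ suc n * 2 ^ suc n)                   ≡⟨ cong (4 *_) (4^n≡2^n*2^n (suc n)) ⟨
    4 ^ (2 + n)                                   ∎
    where open ≡-Reasoning

  Σ-fibre : ∀ {A : Set} (φ : Bool × A → ℕ) b ys →
    Σ ys (λ y → φ (b , y)) ≤ Σ (cartesianProduct bits ys) φ
  Σ-fibre φ b ys = ≤-trans
    (Σ-bits-lower (λ a → Σ ys (λ y → φ (a , y))) b ≤-refl)
    (≤-reflexive (sym (Σ-cartesianProductWith _,_ bits ys φ)))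

  Σ-vertices-lower : ∀ s t (φ : Vertex → ℕ) →
    Σ indices (λ i → Σ indices (λ j → φ (s , t , i , j))) ≤ Σ vertices φ
  Σ-vertices-lower s t φ = begin
    Σ indices (λ i → Σ indices (λ j → φ (s , t , i , j)))
      ≡⟨ Σ-cartesianProductWith _,_ indices indices _ ⟨
    Σ pairs (λ p → φ (s , t , p))
      ≤⟨ Σ-fibre (λ p → φ (s , p)) t pairs ⟩
    Σ (cartesianProduct bits pairs) (λ p → φ (s , p))
      ≤⟨ Σ-fibre φ s (cartesianProduct bits pairs) ⟩
    Σ vertices φ ∎
    where open ≤-Reasoning

  adjacency : Vertex → Vertex → ℕ
  adjacency v w = if does (Adj? v w) then 1 else 0

  Adj⇒1≤ : ∀ v w → Adj v w → 1 ≤ adjacency v w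
  Adj⇒1≤ v w vw rewrite dec-true (Adj? v w) vw = ≤-refl

  -- A sixteenth of the `4 ^ (2 + n)` vertices: a quarter of one of the four blocks. For an arc the
  -- block is that of the points of its side, for a point that of the arcs.
  neighbours-lower : ∀ v → 4 ^ n ≤ Σ vertices (adjacency v)
  neighbours-lower v@(arc s i j) = *-cancelˡ-≤ 2 (begin
    2 * 4 ^ n                 ≡⟨ cong (2 *_) (4^n≡2^n*2^n n) ⟩
    2 * (2 ^ n * 2 ^ n)       ≡⟨ *-assoc 2 (2 ^ n) (2 ^ n) ⟨
    2 ^ suc n * 2 ^ n         ≡⟨ *-comm (2 ^ suc n) (2 ^ n) ⟩
    2 ^ n * 2 ^ suc n         ≡⟨ cong (2 ^ n *_) (*-identityʳ (2 ^ suc n)) ⟨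
    2 ^ n * (2 ^ suc n * 1)
      ≤⟨ Σ-Star-points-lower i j (λ x x∈S → Σ-words-lower (suc n) (λ z → Adj⇒1≤ v (point s x z) (refl , x∈S))) ⟩
    2 * Σ indices (λ x → Σ indices (λ z → adjacency v (point s x z)))
      ≤⟨ *-monoʳ-≤ 2 (Σ-vertices-lower s false (adjacency v)) ⟩
    2 * Σ vertices (adjacency v) ∎)
    where open ≤-Reasoning
  neighbours-lower v@(point s x z) = begin
    4 ^ n                 ≡⟨ 4^n≡2^n*2^n n ⟩
    2 ^ n * 2 ^ n         ≡⟨ cong (2 ^ n *_) (*-identityʳ (2 ^ n)) ⟨
    2 ^ n * (2 ^ n * 1)   ≤⟨ Σ-Star-arcs-lower x (λ i j x∈S → Adj⇒1≤ v (arc s i j) (refl , x∈S)) ⟩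
    Σ indices (λ i → Σ indices (λ j → adjacency v (arc s i j)))
      ≤⟨ Σ-vertices-lower s true (adjacency v) ⟩
    Σ vertices (adjacency v) ∎
    where open ≤-Reasoning

  -- Repeated entries of the list become nonadjacent twins, which allows any number of vertices to
  -- be added.
  blowUp : (xs : List Vertex) → Graph (length xs)
  blowUp xs = record
    { adj   = λ u v → does (Adj? (lookup xs u) (lookup xs v))
    ; sym   = λ u v → does-⇔ (mk⇔ (Adj-sym _ _) (Adj-sym _ _)) (Adj? (lookup xs u) (lookup xs v)) (Adj? (lookup xs v) (lookup xs u))
    ; irref = λ v → dec-false (Adj? (lookup xs v) (lookup xs v)) (Adj-irrefl _)
    }

  degree-lower : ∀ rest u → 4 ^ n ≤ degree (blowUp (vertices ++ rest)) u
  degree-lower rest u = begin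
    4 ^ n                                ≤⟨ neighbours-lower v ⟩
    Σ vertices (adjacency v)             ≤⟨ m≤m+n _ _ ⟩
    Σ vertices (adjacency v) + Σ rest (adjacency v) ≡⟨ Σ-++ vertices rest (adjacency v) ⟨
    Σ (vertices ++ rest) (adjacency v)   ≡⟨ Σ-lookup (vertices ++ rest) (adjacency v) ⟨
    degree (blowUp (vertices ++ rest)) u ∎
    where
    open ≤-Reasoning
    v = lookup (vertices ++ rest) u

  module _ (xs : List Vertex) (H : Subgraph (blowUp xs)) where

    Walk⇒Near : ∀ {u v} → Walk (edge H) 2 u v → Near (lookup xs u) (lookup xs v)
    Walk⇒Near here                     = inj₁ refl
    Walk⇒Near (step e here)            = inj₂ (inj₁ (does-true (Adj? _ _) (e⊆G H _ _ e)))
    Walk⇒Near (step e (step e′ here))  =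
      inj₂ (inj₂ (_ , does-true (Adj? _ _) (e⊆G H _ _ e) , does-true (Adj? _ _) (e⊆G H _ _ e′)))

    -- The vertex halfway along such a walk would lie in both balls of radius two.
    consecutive-far : ∀ {u v i j l} → i ≢ j → j ≢ l →
      lookup xs u ≡ arc true i j → lookup xs v ≡ arc false j l → ¬ Walk (edge H) 4 u v
    consecutive-far {u} {v} {i} {j} {l} i≢j j≢l u≡ v≡ p with Walk-split 2 p
    ... | w , p₁ , p₂ = Ball-disjoint i≢j j≢l (lookup xs w)
      (Near⇒Ball true i j _ (subst (λ a → Near a (lookup xs w)) u≡ (Walk⇒Near p₁)))
      (Near⇒Ball false j l _ (Near-sym _ _ (subst (Near (lookup xs w)) v≡ (Walk⇒Near p₂))))

-- Words as numbers below a power of two.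

module _ where
  open Inverse Fin.2↔Bool

  encode : ∀ {n} → Vec Bool n → Fin (2 ^ n)
  encode []      = zero
  encode (b ∷ v) = combine (from b) (encode v)

  encode-injective : ∀ {n} (u v : Vec Bool n) → encode u ≡ encode v → u ≡ v
  encode-injective []      []      _  = refl
  encode-injective (a ∷ u) (b ∷ v) eq with Fin.combine-injective (from a) (encode u) (from b) (encode v) eq
  ... | a≡b , u≡v = cong₂ _∷_
    (trans (sym (strictlyInverseˡ a)) (trans (cong to a≡b) (strictlyInverseˡ b)))
    (encode-injective u v u≡v)

  decode : ∀ n → Fin (2 ^ n) → Vec Bool n
  decode zero    _ = []
  decode (suc n) k = to (proj₁ (remQuot (2 ^ n) k)) ∷ decode n (proj₂ (remQuot {2} (2 ^ n) k))

  encode-decode : ∀ n k → encode (decode n k) ≡ k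
  encode-decode zero    zero = refl
  encode-decode (suc n) k    = trans
    (cong₂ combine (strictlyInverseʳ (proj₁ (remQuot {2} (2 ^ n) k))) (encode-decode n _))
    (Fin.combine-remQuot {2} (2 ^ n) k)

  decode-injective : ∀ n {k l} → decode n k ≡ decode n l → k ≡ l
  decode-injective n {k} {l} eq =
    trans (sym (encode-decode n k)) (trans (cong encode eq) (encode-decode n l))

-- Partition of the subsets into chains.

module _ {k : ℕ} where

  ⊆-++ʳ : ∀ {m} (u v : Subset m) → u ⊆ v → (s : Subset k) → u Vec.++ s ⊆ v Vec.++ s
  ⊆-++ʳ []      []      u⊆v s x∈ = x∈
  ⊆-++ʳ (_ ∷ u) (_ ∷ v) u⊆v s Vec.here with u⊆v Vec.here
  ... | Vec.here = Vec.here
  ⊆-++ʳ (_ ∷ u) (_ ∷ v) u⊆v s (Vec.there x∈) = Vec.there (⊆-++ʳ u v (drop-∷-⊆ u⊆v) s x∈)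

  Comparable : Subset k → Subset k → Set
  Comparable u v = u ⊆ v ⊎ v ⊆ u

  comparable? : ∀ u v → Dec (Comparable u v)
  comparable? u v = u ⊆? v ⊎-dec v ⊆? u

-- A symmetric chain decomposition of the three-dimensional cube, with chains of sizes 4, 2 and 2.
chain : Subset 3 → Fin 3
chain (false ∷ false ∷ false ∷ []) = zero
chain (true  ∷ false ∷ false ∷ []) = zero
chain (true  ∷ true  ∷ false ∷ []) = zero
chain (true  ∷ true  ∷ true  ∷ []) = zero
chain (false ∷ true  ∷ false ∷ []) = suc zero
chain (false ∷ true  ∷ true  ∷ []) = suc zero
chain (false ∷ false ∷ true  ∷ []) = suc (suc zero)
chain (true  ∷ false ∷ true  ∷ []) = suc (suc zero)

chain-comparable : ∀ u v → chain u ≡ chain v → Comparable u v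
chain-comparable u v eq = decidable-stable (comparable? u v) λ ¬uv →
  -- An exhaustive search for a counterexample, decided by evaluation.
  from-no (anySubset? λ u → anySubset? λ v → chain u Fin.≟ chain v ×-dec ¬? (comparable? u v))
    (u , v , eq , ¬uv)

-- Fixing all but three elements turns each of the three chains into a chain of the whole cube; the
-- code names that chain.
chainCode : ∀ {r} → Subset (3 + r) → Fin (3 * 2 ^ r)
chainCode (a ∷ b ∷ c ∷ s) = combine (chain (a ∷ b ∷ c ∷ [])) (encode s)

chainCode-comparable : ∀ {r} (u v : Subset (3 + r)) → chainCode u ≡ chainCode v → Comparable u v
chainCode-comparable (a ∷ b ∷ c ∷ s) (a′ ∷ b′ ∷ c′ ∷ s′) eq
  with eq₁ , eq₂ ← Fin.combine-injective (chain (a ∷ b ∷ c ∷ [])) (encode s) (chain (a′ ∷ b′ ∷ c′ ∷ [])) (encode s′) eq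
  with refl ← encode-injective s s′ eq₂
  with chain-comparable (a ∷ b ∷ c ∷ []) (a′ ∷ b′ ∷ c′ ∷ []) eq₁
... | inj₁ u⊆v = inj₁ (⊆-++ʳ (a ∷ b ∷ c ∷ []) (a′ ∷ b′ ∷ c′ ∷ []) u⊆v s)
... | inj₂ v⊆u = inj₂ (⊆-++ʳ (a′ ∷ b′ ∷ c′ ∷ []) (a ∷ b ∷ c ∷ []) v⊆u s)

-- Arc colourings of the complete digraph.

module _ {M K : ℕ} (χ : Fin M → Fin M → Fin K) where

  Out : Fin M → Fin K → Set
  Out i c = ∃[ l ] i ≢ l × χ i l ≡ c

  Out? : ∀ i c → Dec (Out i c)
  Out? i c = Fin.any? λ l → ¬? (i Fin.≟ l) ×-dec χ i l Fin.≟ c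

  out : Fin M → Subset K
  out i = Vec.tabulate λ c → does (Out? i c)

  ∈-out⁺ : ∀ {i c} → Out i c → c Subset.∈ out i
  ∈-out⁺ {i} {c} o = Vec.lookup⇒[]= c (out i) (trans (Vec.lookup∘tabulate _ c) (dec-true (Out? i c) o))

  ∈-out⁻ : ∀ {i c} → c Subset.∈ out i → Out i c
  ∈-out⁻ {i} {c} c∈ = does-true (Out? i c) (trans (sym (Vec.lookup∘tabulate _ c)) (Vec.[]=⇒lookup c∈))

  Monochromatic : Set
  Monochromatic = ∃[ i ] ∃[ j ] ∃[ l ] i ≢ j × j ≢ l × χ i j ≡ χ j l

  -- The colour of the arc from `i` to `j` leaves `i`, hence also leaves `j` along some arc,
  -- possibly back to `i`.
  out-⊆⇒monochromatic : ∀ {i j} → i ≢ j → out i ⊆ out j → Monochromatic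
  out-⊆⇒monochromatic {i} {j} i≢j i⊆j with ∈-out⁻ (i⊆j (∈-out⁺ (j , i≢j , refl)))
  ... | l , j≢l , eq = i , j , l , i≢j , j≢l , sym eq

monochromatic-consecutive : ∀ {M r} → 3 * 2 ^ r < M → (χ : Fin M → Fin M → Fin (3 + r)) → Monochromatic χ
monochromatic-consecutive M> χ
  with i , j , i<j , eq ← Fin.pigeonhole M> (chainCode ∘ out χ)
  with chainCode-comparable (out χ i) (out χ j) eq
... | inj₁ i⊆j = out-⊆⇒monochromatic χ (Fin.<⇒≢ i<j) i⊆j
... | inj₂ j⊆i = out-⊆⇒monochromatic χ (Fin.<⇒≢ i<j ∘ sym) j⊆i

-- Here K is `3 + r`; the start at `4 ^ 3` ensures that three colours can be split off.
between-powers-of-4 : ∀ d → ∃[ r ] 4 ^ (3 + r) ≤ 4 ^ 3 + d × 4 ^ 3 + d < 4 ^ (4 + r)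
between-powers-of-4 zero = 0 , ≤-refl , from-yes (65 ≤? 256)
between-powers-of-4 (suc d) with between-powers-of-4 d
... | r , lo , hi with suc (4 ^ 3 + d) <? 4 ^ (4 + r)
... | yes hi′ = r , m≤n⇒m≤1+n lo , hi′
... | no  ¬hi = suc r , ≮⇒≥ ¬hi , <-≤-trans (s≤s hi) (^-monoʳ-< 4 (s≤s (s≤s z≤n)) (n<1+n (4 + r)))

3*2^r<2^[2+r] : ∀ r → 3 * 2 ^ r < 2 ^ (2 + r)
3*2^r<2^[2+r] r = subst (3 * 2 ^ r <_) (*-assoc 2 2 (2 ^ r))
  (*-monoˡ-< (2 ^ r) {{m^n≢0 2 r}} (n<1+n 3))

-- From a cover to an arc colouring.

module _ (r : ℕ) where
  -- This parameter gives M = `2 ^ (2 + r)` indices and `4 ^ (3 + r)` vertices, matching K =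
  -- `3 + r`.
  open Construction (suc r)

  module _ (rest : List Vertex) where

    graph : Graph (length (vertices ++ rest))
    graph = blowUp (vertices ++ rest)

    position : Vertex → Fin (length (vertices ++ rest))
    position v = Any.index (∈-++⁺ˡ {ys = rest} (vertices-complete v))

    lookup-position : ∀ v → lookup (vertices ++ rest) (position v) ≡ v
    lookup-position v = sym (lookup-index (∈-++⁺ˡ {ys = rest} (vertices-complete v)))

    tail head : Index → Index → Fin (length (vertices ++ rest))
    tail i j = position (arc true i j)
    head i j = position (arc false i j)

    tail-head-adj : ∀ i j → adj graph (tail i j) (head i j) ≡ true
    tail-head-adj i j = dec-true (Adj? _ _) (subst₂ Adj
      (sym (lookup-position (arc true i j))) (sym (lookup-position (arc false i j)))
      ((λ ()) , refl , refl))

    uncoverable : ∀ {k} → k ≤ 3 + r → (H : Fin k → Subgraph graph) →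
      (∀ c → DiamAtMost 4 (H c)) → ¬ CoversEdges graph H
    uncoverable {k} k≤ H diam covers = contra (monochromatic-consecutive (3*2^r<2^[2+r] r) χ)
      where
      word : Fin (2 ^ (2 + r)) → Index
      word = decode (2 + r)

      cover : ∀ i j → ∃[ c ] edge (H c) (tail i j) (head i j) ≡ true
      cover i j = covers _ _ (tail-head-adj i j)

      χ : (i j : Fin (2 ^ (2 + r))) → Fin (3 + r)
      -- An arc is coloured by a subgraph covering its edge; `inject≤` allows fewer than K
      -- subgraphs.
      χ i j = inject≤ (proj₁ (cover (word i) (word j))) k≤

      consecutive-differ : ∀ {i j l} → i ≢ j → j ≢ l → proj₁ (cover i j) ≢ proj₁ (cover j l)
      consecutive-differ {i} {j} {l} i≢j j≢l eq = consecutive-far (vertices ++ rest) (H c) i≢j j≢l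
        (lookup-position (arc true i j)) (lookup-position (arc false j l))
        -- Both edges lie in subgraph `c`, so the tail of the first and the head of the second are
        -- vertices of it.
        (diam c (tail i j) (head j l)
          (proj₁ (e⊆vert (H c) (tail i j) (head i j) (proj₂ (cover i j))))
          (proj₂ (e⊆vert (H c) (tail j l) (head j l)
            (subst (λ c → edge (H c) (tail j l) (head j l) ≡ true) (sym eq) (proj₂ (cover j l))))))
        where c = proj₁ (cover i j)

      contra : ¬ Monochromatic χ
      contra (i , j , l , i≢j , j≢l , eq) = consecutive-differ
        (i≢j ∘ decode-injective (2 + r)) (j≢l ∘ decode-injective (2 + r))
        (Fin.inject≤-injective k≤ k≤ (proj₁ (cover (word i) (word j))) (proj₁ (cover (word j) (word l))) eq)

-- All large vertex counts, by padding with twins.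

theorem3p2 : ∃[ N₀ ] ∀ (N : ℕ) → N₀ ≤ N →
    ∃[ G ] ((∀ (v : Fin N) → N ≤ 256 * degree G v) ×
    (∀ (k : ℕ) → 4 ^ k ≤ N → (H : Fin k → Subgraph G) →
    (∀ i → DiamAtMost 4 (H i)) → ¬ CoversEdges G H))
theorem3p2 = 4 ^ 3 , λ N 4^3≤N →
  let d , 4^3+d≡N = m≤n⇒∃[o]m+o≡n 4^3≤N
      r , lo , hi = between-powers-of-4 d
      length≡N    = length-padded r (subst (4 ^ (3 + r) ≤_) 4^3+d≡N lo)
  in subst Uncoverable length≡N (uncoverable-blowUp r (padding r N)
       (subst (_< 4 ^ (4 + r)) (trans 4^3+d≡N (sym length≡N)) hi))
  where
  open Construction using (Vertex; vertices; length-vertices; degree-lower)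

  Uncoverable : ℕ → Set
  Uncoverable N = ∃[ G ] ((∀ (v : Fin N) → N ≤ 256 * degree G v) ×
    (∀ (k : ℕ) → 4 ^ k ≤ N → (H : Fin k → Subgraph G) →
    (∀ i → DiamAtMost 4 (H i)) → ¬ CoversEdges G H))

  padding : ∀ r → ℕ → List (Vertex (suc r))
  -- The choice of the repeated vertex is arbitrary, since the degree bound holds for all.
  padding r N = replicate (N ∸ 4 ^ (3 + r)) (true , true , Vec.replicate _ true , Vec.replicate _ true)

  length-padded : ∀ r {N} → 4 ^ (3 + r) ≤ N → length (vertices (suc r) ++ padding r N) ≡ N
  length-padded r {N} 4^≤N = begin
    length (vertices (suc r) ++ padding r N)        ≡⟨ List.length-++ (vertices (suc r)) ⟩
    length (vertices (suc r)) + length (padding r N) ≡⟨ cong₂ _+_ (length-vertices (suc r)) (List.length-replicate _) ⟩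
    4 ^ (3 + r) + (N ∸ 4 ^ (3 + r))                 ≡⟨ m+[n∸m]≡n 4^≤N ⟩
    N                                               ∎
    where open ≡-Reasoning

  uncoverable-blowUp : ∀ r rest → length (vertices (suc r) ++ rest) < 4 ^ (4 + r) →
    Uncoverable (length (vertices (suc r) ++ rest))
  uncoverable-blowUp r rest N< = graph r rest , min-degree , λ k 4^k≤N → uncoverable r rest (k≤3+r 4^k≤N)
    where
    open ≤-Reasoning
    min-degree : ∀ v → length (vertices (suc r) ++ rest) ≤ 256 * degree (graph r rest) v
    min-degree v = begin
      length (vertices (suc r) ++ rest) ≤⟨ <⇒≤ N< ⟩
      -- A factor of four is given away to arrive at the constant 256 = `4 ^ 4`.
      4 ^ (4 + r)                       ≤⟨ ^-monoʳ-≤ 4 (n≤1+n (4 + r)) ⟩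
      4 ^ (4 + suc r)                   ≡⟨ ^-distribˡ-+-* 4 4 (suc r) ⟩
      256 * 4 ^ suc r                   ≤⟨ *-monoʳ-≤ 256 (degree-lower (suc r) rest v) ⟩
      256 * degree (graph r rest) v     ∎
    k≤3+r : ∀ {k} → 4 ^ k ≤ length (vertices (suc r) ++ rest) → k ≤ 3 + r
    k≤3+r 4^k≤N = ≮⇒≥ λ 3+r<k → <⇒≱ N< (≤-trans (^-monoʳ-≤ 4 3+r<k) 4^k≤N)
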